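{- Let $G$ and $H$ be finite simple connected graphs, neither of which is a complete graph. Then $th(G\boxtimes H)=2$.
   Context: The strong product $G\boxtimes H$ has vertex set $V(G)\times V(H)$; $(g_1,h_1)$ and $(g_2,h_2)$ are adjacent iff ($g_1g_2\in E(G)$ and $h_1=h_2$) or ($g_1=g_2$ and $h_1h_2\in E(H)$) or ($g_1g_2\in E(G)$ and $h_1h_2\in E(H)$). For two different non-adjacent vertices $u,v$ of a graph $F$, a tolled walk between $u$ and $v$ is a sequence of vertices $u,w_1,\dots,w_k,v$ with $k\ge 1$ such that consecutive vertices of $w_1,\dots,w_k$ are adjacent, $uw_i\in E(F)$ if and only if $i=1$, and $vw_i\in E(F)$ if and only if $i=k$. If $uv\in E(F)$, the only tolled walk between $u$ and $v$ is $u,v$; the only tolled walk from $v$ to itself is the single vertex $v$. The toll interval $T_F(u,v)$ is the set of all vertices of $F$ lying on some tolled walk between $u$ and $v$. A set $S\subseteq V(F)$ is toll convex (t-convex) if $T_F(u,v)\subseteq S$ for all $u,v\in S$. The t-convex hull $[S]_t$ of $S\subseteq V(F)$ is the intersection of all t-convex sets containing $S$. $S$ is a t-hull set of $F$ if $[S]_t=V(F)$, and the t-hull number $th(F)$ is the minimum size of a t-hull set of $F$. -}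

module Defs where

open import Data.Fin.Base using (Fin; zero; suc; inject₁; fromℕ)
open import Data.Fin.Properties using (*↔×) renaming (_≟_ to _≟ᶠ_)
import Data.Fin.Subset as Subset
open import Data.List.Base using (List; []; _∷_; [_]; _++_; tabulate)
open import Data.List.Membership.Propositional using (_∈_)
open import Data.Nat.Base using (ℕ; _≤_; _*_)
open import Data.Product.Base using (∃; ∃-syntax; _×_; _,_)
open import Data.Product.Function.NonDependent.Propositional using (_×-↔_)
open import Data.Sum.Base using (_⊎_; inj₁; inj₂)
open import Function.Bundles using (_↔_; _⇔_; Inverse)
open import Function.Construct.Composition using (_↔-∘_)
open import Function.Construct.Symmetry using (↔-sym)
open import Function.Properties.Inverse using (↔⇒↣)
open import Level using (0ℓ)
open import Relation.Binary.Construct.Closure.ReflexiveTransitive using (Star)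
open import Relation.Binary.Core using (Rel)
open import Relation.Binary.Definitions
  using (Decidable; DecidableEquality; Irreflexive; Symmetric)
open import Relation.Binary.PropositionalEquality using (_≡_; _≢_; refl; sym)
open import Relation.Nullary.Decidable using (_×-dec_; _⊎-dec_; via-injection)
open import Relation.Nullary.Negation using (¬_)
open import Relation.Unary using (Pred; _⊆_; Universal)

-- Finite simple graphs.  Decidability of adjacency is automatic classically.
record Graph : Set₁ where
  field
    V      : Set
    order  : ℕ
    enum   : V ↔ Fin order
    Adj    : Rel V 0ℓ
    adj?   : Decidable Adj
    symm   : Symmetric Adj
    irrefl : Irreflexive _≡_ Adj

  _≟_ : DecidableEquality V
  _≟_ = via-injection (↔⇒↣ enum) _≟ᶠ_

  VertexSet : Set
  VertexSet = Subset.Subset order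

  ⟦_⟧ : VertexSet → Pred V 0ℓ
  ⟦ S ⟧ v = Inverse.to enum v Subset.∈ S

Connected : Graph → Set
Connected G = ∀ u v → Star Adj u v
  where open Graph G

-- The graph without vertices counts as complete.
Complete : Graph → Set
Complete G = ∀ u v → u ≢ v → Adj u v
  where open Graph G

infixr 7 _⊠_

_⊠_ : Graph → Graph → Graph
G ⊠ H = record
  { V      = G.V × H.V
  ; order  = G.order * H.order
  ; enum   = ↔-sym *↔× ↔-∘ (G.enum ×-↔ H.enum)
  ; Adj    = λ (g₁ , h₁) (g₂ , h₂) →
               (G.Adj g₁ g₂ × h₁ ≡ h₂)
             ⊎ (g₁ ≡ g₂ × H.Adj h₁ h₂)
             ⊎ (G.Adj g₁ g₂ × H.Adj h₁ h₂)
  ; adj?   = λ (g₁ , h₁) (g₂ , h₂) →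
               (G.adj? g₁ g₂ ×-dec (h₁ H.≟ h₂))
         ⊎-dec ((g₁ G.≟ g₂) ×-dec H.adj? h₁ h₂)
         ⊎-dec (G.adj? g₁ g₂ ×-dec H.adj? h₁ h₂)
  ; symm   = λ { (inj₁ (a , e))        → inj₁ (G.symm a , sym e)
               ; (inj₂ (inj₁ (e , b))) → inj₂ (inj₁ (sym e , H.symm b))
               ; (inj₂ (inj₂ (a , b))) → inj₂ (inj₂ (G.symm a , H.symm b))
               }
  ; irrefl = λ { refl (inj₁ (a , _))        → G.irrefl refl a
               ; refl (inj₂ (inj₁ (_ , b))) → H.irrefl refl b
               ; refl (inj₂ (inj₂ (a , _))) → G.irrefl refl a
               }
  }
  where
  module G = Graph G
  module H = Graph H

module _ (F : Graph) where
  open Graph F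

  -- In `walk`, w lists the inner vertices w₁, …, wₖ₊₁ indexed from zero; so
  -- there is at least one, the first is w zero and the last is w (fromℕ k).
  data TolledWalk : V → V → Set where
    single : ∀ v → TolledWalk v v
    edge   : ∀ {u v} → Adj u v → TolledWalk u v
    walk   : ∀ {u v} → u ≢ v → ¬ Adj u v →
             (k : ℕ) (w : Fin (ℕ.suc k) → V) →
             (∀ (i : Fin k) → Adj (w (inject₁ i)) (w (suc i))) →
             (∀ i → Adj u (w i) ⇔ i ≡ zero) →
             (∀ i → Adj v (w i) ⇔ i ≡ fromℕ k) →
             TolledWalk u v

  vertices : ∀ {u v} → TolledWalk u v → List V
  vertices         (single v)             = [ v ]
  vertices {u} {v} (edge _)               = u ∷ v ∷ []
  vertices {u} {v} (walk _ _ _ w _ _ _)   = u ∷ tabulate w ++ [ v ]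

  TollInterval : V → V → Pred V 0ℓ
  TollInterval u v x = ∃[ p ] x ∈ vertices {u} {v} p

  TConvex : VertexSet → Set
  TConvex S = ∀ {u v} → ⟦ S ⟧ u → ⟦ S ⟧ v → TollInterval u v ⊆ ⟦ S ⟧

  Hull : VertexSet → Pred V 0ℓ
  Hull S x = ∀ (C : VertexSet) → TConvex C → ⟦ S ⟧ ⊆ ⟦ C ⟧ → ⟦ C ⟧ x

  IsTHullSet : VertexSet → Set
  IsTHullSet S = Universal (Hull S)

  -- th(F) = k, i.e. k is the minimum size of a t-hull set.  The full vertex
  -- set is a t-hull set, so exactly one such k exists (classically).
  IsTHullNumber : ℕ → Set
  IsTHullNumber k = (∃[ S ] IsTHullSet S × Subset.∣ S ∣ ≡ k)
                  × (∀ S → IsTHullSet S → k ≤ Subset.∣ S ∣)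

{-# OPTIONS --safe #-}

-- If g is not universal in G and h is not universal in H, then deleting the
-- closed neighbourhood N[(g,h)] = N[g] × N[h] leaves G ⊠ H connected: the
-- fibres over vertices outside N[g] and the layers over vertices outside N[h]
-- survive whole.  Hence the toll interval of a non-adjacent pair of such
-- vertices contains every x whose closed neighbourhood is contained in neither
-- of theirs.  Let g, g' and h, h' be non-adjacent pairs.  As N[a] cannot lie in
-- both N[g] and N[g'], each vertex lies in the toll interval of (g,h), (g',h')
-- or in that of (g,h'), (g',h), and the latter two vertices lie in the former
-- interval.  So {(g,h), (g',h')} is a t-hull set.
module Submission where

open import Defs
open import Data.Fin.Base using (Fin; zero; suc; inject₁; fromℕ)
open import Data.Fin.Properties using (any?; suc-injective)
open import Data.Fin.Subset using (Subset; ∣_∣; ⁅_⁆; _∪_; _∈_; inside; outside)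
open import Data.Fin.Subset.Properties
  using (∣⁅x⁆∣≡1; x∈⁅x⁆; x∈p∪q⁺; x∈p∧x≢y⇒x∈p-y; x∈p⇒∣p-x∣<∣p∣)
open import Data.List.Membership.Propositional using () renaming (_∈_ to _∈ˡ_)
open import Data.List.Membership.Propositional.Properties using (∈-++⁺ˡ; ∈-tabulate⁺)
open import Data.List.Relation.Unary.Any using (here; there)
open import Data.Nat.Base using (ℕ; suc; _+_; _≤_; z≤n; s≤s)
open import Data.Nat.Properties
  using (≤-antisym; ≤-trans; ≤-reflexive; _≤?_; +-suc; +-monoʳ-≤; n≤1+n; m<n⇒0<n)
open import Data.Product.Base using (∃; ∃-syntax; _×_; _,_; proj₁)
open import Data.Sum.Base using (_⊎_; inj₁; inj₂)
open import Data.Vec.Base using ([]; _∷_)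
open import Function.Base using (_∘_; id)
open import Function.Bundles using (_⇔_; mk⇔; Inverse; Equivalence; Injection)
open import Function.Properties.Inverse using (↔⇒↣)
open import Relation.Binary.Construct.Closure.ReflexiveTransitive
  using (Star; ε; _◅_; _◅◅_; gmap)
open import Relation.Binary.PropositionalEquality
  using (_≡_; _≢_; refl; sym; cong; cong₂; subst)
open import Relation.Nullary.Decidable
  using (Dec; yes; no; ¬?; _×-dec_; map′; decidable-stable)
open import Relation.Nullary.Negation using (¬_; contradiction)
open import Relation.Unary using (Decidable)

-- Sizes of finite subsets.

∣p∪q∣≤∣p∣+∣q∣ : ∀ {n} (p q : Subset n) → ∣ p ∪ q ∣ ≤ ∣ p ∣ + ∣ q ∣
∣p∪q∣≤∣p∣+∣q∣ []            []            = z≤n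
∣p∪q∣≤∣p∣+∣q∣ (outside ∷ p) (outside ∷ q) = ∣p∪q∣≤∣p∣+∣q∣ p q
∣p∪q∣≤∣p∣+∣q∣ (inside  ∷ p) (outside ∷ q) = s≤s (∣p∪q∣≤∣p∣+∣q∣ p q)
∣p∪q∣≤∣p∣+∣q∣ (outside ∷ p) (inside  ∷ q) =
  ≤-trans (s≤s (∣p∪q∣≤∣p∣+∣q∣ p q)) (≤-reflexive (sym (+-suc ∣ p ∣ ∣ q ∣)))
∣p∪q∣≤∣p∣+∣q∣ (inside  ∷ p) (inside  ∷ q) =
  s≤s (≤-trans (∣p∪q∣≤∣p∣+∣q∣ p q) (+-monoʳ-≤ ∣ p ∣ (n≤1+n ∣ q ∣)))

x≢y⇒2≤∣p∣ : ∀ {n} {p : Subset n} {x y} → x ∈ p → y ∈ p → x ≢ y → 2 ≤ ∣ p ∣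
x≢y⇒2≤∣p∣ x∈p y∈p x≢y =
  -- Deleting `y` lowers the size and leaves `x`, whose deletion lowers it again.
  ≤-trans (s≤s (m<n⇒0<n (x∈p⇒∣p-x∣<∣p∣ (x∈p∧x≢y⇒x∈p-y x∈p x≢y))))
          (x∈p⇒∣p-x∣<∣p∣ y∈p)

x≢y⇒∣⁅x⁆∪⁅y⁆∣≡2 : ∀ {n} {x y : Fin n} → x ≢ y → ∣ ⁅ x ⁆ ∪ ⁅ y ⁆ ∣ ≡ 2
x≢y⇒∣⁅x⁆∪⁅y⁆∣≡2 {x = x} {y} x≢y = ≤-antisym
  (≤-trans (∣p∪q∣≤∣p∣+∣q∣ ⁅ x ⁆ ⁅ y ⁆)
           (≤-reflexive (cong₂ _+_ (∣⁅x⁆∣≡1 x) (∣⁅x⁆∣≡1 y))))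
  (x≢y⇒2≤∣p∣ (x∈p∪q⁺ {p = ⁅ x ⁆} (inj₁ (x∈⁅x⁆ x)))
             (x∈p∪q⁺ {q = ⁅ y ⁆} (inj₂ (x∈⁅x⁆ y))) x≢y)

-- Tolled walks and toll convexity in an arbitrary graph.

module _ (F : Graph) where
  open Graph F

  to-injective : ∀ {x y} → Inverse.to enum x ≡ Inverse.to enum y → x ≡ y
  to-injective = Injection.injective (↔⇒↣ enum)

  ∃V? : {P : V → Set} → Decidable P → Dec (∃ P)
  ∃V? {P} P? = map′
    (λ (i , p) → Inverse.from enum i , p)
    (λ (x , p) → Inverse.to enum x ,
                 subst P (sym (Inverse.strictlyInverseʳ enum x)) p)
    (any? (P? ∘ Inverse.from enum))

  Far : V → V → Set
  Far x y = x ≢ y × ¬ Adj x y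

  Far-sym : ∀ {x y} → Far x y → Far y x
  Far-sym (x≢y , ¬xy) = x≢y ∘ sym , ¬xy ∘ symm

  ¬Complete⇒∃Far : ¬ Complete F → ∃[ x ] ∃[ y ] Far x y
  ¬Complete⇒∃Far ¬complete
    with ∃V? (λ x → ∃V? (λ y → ¬? (x ≟ y) ×-dec ¬? (adj? x y)))
  ... | yes far = far
  ... | no ¬far = contradiction
    (λ x y x≢y → decidable-stable (adj? x y) λ ¬xy → ¬far (x , y , x≢y , ¬xy))
    ¬complete

  -- Escapes u x says that N[x] is not contained in N[u].
  Escapes : V → V → Set
  Escapes u x = ∃[ y ] (y ≡ x ⊎ Adj y x) × Far u y

  -- If `x` is in N[u], then `u` itself witnesses the escape from `u′`; otherwise `x` witnesses its
  -- own escape from `u`.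
  Far⇒Escapes : ∀ {u u′} → Far u u′ → ∀ x → Escapes u x ⊎ Escapes u′ x
  Far⇒Escapes {u} {u′} u-u′ x with u ≟ x | adj? u x
  ... | yes refl | _      = inj₂ (u , inj₁ refl , Far-sym u-u′)
  ... | no _     | yes ux = inj₂ (u , inj₂ ux , Far-sym u-u′)
  ... | no u≢x   | no ¬ux = inj₁ (x , inj₁ refl , u≢x , ¬ux)

  -- The part of a tolled walk from u to v that lies between u and x, except
  -- that x may be adjacent to v.
  data Approach (u v : V) : V → Set where
    start : ∀ {x} → Adj u x → Approach u v x
    step  : ∀ {x y} → Approach u v y → ¬ Adj v y → Adj y x → ¬ Adj u x →
            Approach u v x

  -- The rest of a tolled walk, from `x` up to the neighbour of `v`. Whether `x` is adjacent to `u`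
  -- is left open, so `avoids` starts at the second vertex. The marked vertex `z` is the one to be
  -- placed in the toll interval.
  record Tail (u v x z : V) : Set where
    field
      length : ℕ
      inner  : Fin (suc length) → V
      head   : inner zero ≡ x
      linked : ∀ i → Adj (inner (inject₁ i)) (inner (suc i))
      avoids : ∀ i → ¬ Adj u (inner (suc i))
      ends   : ∀ i → Adj v (inner i) ⇔ i ≡ fromℕ length
      index  : Fin (suc length)
      visits : inner index ≡ z

  cons : ∀ {u v x y z} → ¬ Adj v y → Adj y x → ¬ Adj u x →
         Tail u v x z → Tail u v y z
  cons {u} {v} {x} {y} ¬vy yx ¬ux t = record
    { length = suc length
    ; inner  = w
    ; head   = refl
    ; linked = λ { zero → subst (Adj y) (sym head) yx ; (suc i) → linked i }
    ; avoids = λ { zero → ¬ux ∘ subst (Adj u) head ; (suc i) → avoids i }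
    ; ends   = λ { zero    → mk⇔ (λ vy → contradiction vy ¬vy) (λ ())
                 ; (suc i) → mk⇔ (cong suc ∘ Equivalence.to (ends i))
                                 (Equivalence.from (ends i) ∘ suc-injective) }
    ; index  = suc index
    ; visits = visits
    }
    where
    open Tail t
    w : Fin (suc (suc length)) → V
    w zero    = y
    w (suc i) = inner i

  retarget : ∀ {u v x z} → Tail u v x z → Tail u v x x
  retarget t = record { Tail t ; index = zero ; visits = Tail.head t }

  -- The exemptions agree: an approach from `v` may end at a neighbour of `u`, and a tail may begin
  -- at one.
  reverse : ∀ {u v x} → Approach v u x → Tail u v x x
  reverse {x = x} (start vx) = record
    { length = 0
    ; inner  = λ _ → x
    ; head   = refl
    ; linked = λ ()
    ; avoids = λ ()
    ; ends   = λ { zero → mk⇔ (λ _ → refl) (λ _ → vx) }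
    ; index  = zero
    ; visits = refl
    }
  reverse (step p ¬uy yx ¬vx) = retarget (cons ¬vx (symm yx) ¬uy (reverse p))

  -- At `x` the approach settles adjacency to `u` and the tail adjacency to `v`. The two halves may
  -- share vertices, since a tolled walk may repeat them.
  prepend : ∀ {u v x z} → Far u v → Approach u v x → Tail u v x z →
            TollInterval F u v z
  prepend far (step p ¬vy yx ¬ux) t = prepend far p (cons ¬vy yx ¬ux t)
  prepend {u} {v} {z = z} (u≢v , ¬uv) (start ux) t =
    walk u≢v ¬uv length inner linked starts ends ,
    there (subst (_∈ˡ _) visits (∈-++⁺ˡ (∈-tabulate⁺ {f = inner} index)))
    where
    open Tail t
    starts : ∀ i → Adj u (inner i) ⇔ i ≡ zero
    starts zero    = mk⇔ (λ _ → refl) (λ _ → subst (Adj u) (sym head) ux)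
    starts (suc i) = mk⇔ (λ a → contradiction a (avoids i)) (λ ())

  -- Only the source of each step is constrained, so a path may end at a neighbour of `v`.
  Reach : V → V → V → Set
  Reach v = Star (λ x y → ¬ Adj v x × Adj x y)

  -- Each visit of the path to N(u) restarts the walk.
  Reach⇒Approach : ∀ {u v x} → Reach v u x → x ≡ u ⊎ Approach u v x
  Reach⇒Approach {u} {v} = go (inj₁ refl)
    where
    go : ∀ {x y} → x ≡ u ⊎ Approach u v x → Reach v x y → y ≡ u ⊎ Approach u v y
    go p ε = p
    go {x} p (_◅_ {j = y} (¬vx , xy) r) with adj? u y | p
    ... | yes uy | _         = go (inj₂ (start uy)) r
    ... | no ¬uy | inj₁ refl = contradiction xy ¬uy
    ... | no ¬uy | inj₂ q    = go (inj₂ (step q ¬vx xy ¬uy)) r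

  reachable⇒∈ : ∀ {C} → TConvex F C → ∀ {u v x} → ⟦ C ⟧ u → ⟦ C ⟧ v → Far u v →
                Reach v u x → Reach u v x → ⟦ C ⟧ x
  reachable⇒∈ convex u∈C v∈C far r s with Reach⇒Approach r | Reach⇒Approach s
  ... | inj₁ refl | _         = u∈C
  ... | inj₂ _    | inj₁ refl = v∈C
  ... | inj₂ p    | inj₂ q    = convex u∈C v∈C (prepend far p (reverse q))

  subsingleton⇒TConvex : ∀ {S} → (∀ {x y} → ⟦ S ⟧ x → ⟦ S ⟧ y → x ≡ y) → TConvex F S
  subsingleton⇒TConvex eq u∈S v∈S (single _ , here refl)      = u∈S
  subsingleton⇒TConvex eq u∈S v∈S (edge uv , _)               =
    contradiction uv (irrefl (eq u∈S v∈S))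
  subsingleton⇒TConvex eq u∈S v∈S (walk u≢v _ _ _ _ _ _ , _) =
    contradiction (eq u∈S v∈S) u≢v

  -- A set with at most one vertex is t-convex, hence its own hull, and cannot contain both `x` and
  -- `y`.
  hullSet⇒2≤∣S∣ : ∀ {x y} → x ≢ y → ∀ S → IsTHullSet F S → 2 ≤ ∣ S ∣
  hullSet⇒2≤∣S∣ {x} {y} x≢y S hull = decidable-stable (2 ≤? ∣ S ∣) λ 2≰ →
    let eq : ∀ {x y} → ⟦ S ⟧ x → ⟦ S ⟧ y → x ≡ y
        eq {x} {y} x∈S y∈S = decidable-stable (x ≟ y) λ x≢y →
          2≰ (x≢y⇒2≤∣p∣ x∈S y∈S (x≢y ∘ to-injective))
        full = λ z → hull z S (subsingleton⇒TConvex eq) id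
    in x≢y (eq (full x) (full y))

-- Toll hulls in the strong product.

module _ (G H : Graph) (connG : Connected G) (connH : Connected H) where
  private
    module G = Graph G
    module H = Graph H
    F = G ⊠ H
    module F = Graph F

  Outside : F.V → F.V → Set
  Outside (g , h) (a , b) = Far G g a ⊎ Far H h b

  Outside⇒¬Adj : ∀ {u x} → Outside u x → ¬ F.Adj u x
  Outside⇒¬Adj (inj₁ (_ , ¬ga)) (inj₁ (ga , _))          = ¬ga ga
  Outside⇒¬Adj (inj₁ (g≢a , _)) (inj₂ (inj₁ (g≡a , _)))  = g≢a g≡a
  Outside⇒¬Adj (inj₁ (_ , ¬ga)) (inj₂ (inj₂ (ga , _)))   = ¬ga ga
  Outside⇒¬Adj (inj₂ (h≢b , _)) (inj₁ (_ , h≡b))         = h≢b h≡b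
  Outside⇒¬Adj (inj₂ (_ , ¬hb)) (inj₂ (inj₁ (_ , hb)))   = ¬hb hb
  Outside⇒¬Adj (inj₂ (_ , ¬hb)) (inj₂ (inj₂ (_ , hb)))   = ¬hb hb

  Outside⇒Far : ∀ {u x} → Outside u x → Far F u x
  Outside⇒Far o = distinct o , Outside⇒¬Adj o
    where
    distinct : ∀ {u x} → Outside u x → u ≢ x
    distinct (inj₁ (g≢a , _)) refl = g≢a refl
    distinct (inj₂ (h≢b , _)) refl = h≢b refl

  fibre : ∀ {g h a b b′} → Far G g a → Reach F (g , h) (a , b) (a , b′)
  fibre {a = a} {b} {b′} ga =
    gmap (a ,_) (λ e → Outside⇒¬Adj (inj₁ ga) , inj₂ (inj₁ (refl , e))) (connH b b′)

  layer : ∀ {g h a a′ b} → Far H h b → Reach F (g , h) (a , b) (a′ , b)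
  layer {a = a} {a′} {b} hb =
    gmap (_, b) (λ e → Outside⇒¬Adj (inj₂ hb) , inj₁ (e , refl)) (connG a a′)

  outside-connected : ∀ {g h g* h*} → Far G g g* → Far H h h* →
    ∀ {x y} → Outside (g , h) x → Outside (g , h) y → Reach F (g , h) x y
  -- Two surviving fibres are joined along the layer at `h*`; two surviving layers, along the fibre
  -- at `g*`.
  outside-connected g* h* (inj₁ a) (inj₁ a′) = fibre a ◅◅ layer h* ◅◅ fibre a′
  outside-connected g* h* (inj₁ a) (inj₂ b′) = fibre a ◅◅ layer b′
  outside-connected g* h* (inj₂ b) (inj₁ a′) = layer b ◅◅ fibre a′
  outside-connected g* h* (inj₂ b) (inj₂ b′) = layer b ◅◅ fibre g* ◅◅ layer b′

  -- Closed neighbourhoods are non-empty, so N[a] × N[b] fails to lie in N[g] × N[h] exactly when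
  -- one factor fails.
  Escapes₂ : F.V → F.V → Set
  Escapes₂ (g , h) (a , b) = Escapes G g a ⊎ Escapes H h b

  -- The escape witness lies outside N[(g,h)] and is reached there; at most one further step leads
  -- to `x`, which may lie inside.
  escapes⇒Reach : ∀ {g h g* h* x} → Far G g g* → Far H h h* →
    Escapes₂ (g , h) x → Reach F (g , h) (g* , h*) x
  escapes⇒Reach g* h* (inj₁ (y , inj₁ refl , far)) =
    outside-connected g* h* (inj₁ g*) (inj₁ far)
  escapes⇒Reach g* h* (inj₁ (y , inj₂ ya , far)) =
    outside-connected g* h* (inj₁ g*) (inj₁ far)
      ◅◅ (Outside⇒¬Adj (inj₁ far) , inj₁ (ya , refl)) ◅ ε
  escapes⇒Reach g* h* (inj₂ (y , inj₁ refl , far)) =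
    outside-connected g* h* (inj₁ g*) (inj₂ far)
  escapes⇒Reach g* h* (inj₂ (y , inj₂ yb , far)) =
    outside-connected g* h* (inj₁ g*) (inj₂ far)
      ◅◅ (Outside⇒¬Adj (inj₂ far) , inj₂ (inj₁ (refl , yb))) ◅ ε

  escapes⇒∈ : ∀ {g g′ h h′} → Far G g g′ → Far H h h′ →
    ∀ {C} → TConvex F C → F.⟦ C ⟧ (g , h) → F.⟦ C ⟧ (g′ , h′) →
    ∀ {x} → Escapes₂ (g , h) x → Escapes₂ (g′ , h′) x → F.⟦ C ⟧ x
  escapes⇒∈ gg′ hh′ {C} convex u∈C v∈C e e′ =
    reachable⇒∈ F {C} convex u∈C v∈C (Outside⇒Far (inj₁ gg′))
      -- The path from (g,h) has to avoid the neighbours of (g′,h′), hence the use of `e′`.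
      (escapes⇒Reach (Far-sym G gg′) (Far-sym H hh′) e′)
      (escapes⇒Reach gg′ hh′ e)

  diagonal-hull : ∀ {g g′ h h′} → Far G g g′ → Far H h h′ →
    ∀ {C} → TConvex F C → F.⟦ C ⟧ (g , h) → F.⟦ C ⟧ (g′ , h′) → ∀ x → F.⟦ C ⟧ x
  diagonal-hull {g} {g′} {h} {h′} gg′ hh′ {C} convex u∈C v∈C (a , b) =
    case (Far⇒Escapes G gg′ a) (Far⇒Escapes H hh′ b)
    where
    h′h : Far H h′ h
    h′h = Far-sym H hh′

    diagonal : ∀ {x} → Escapes₂ (g , h) x → Escapes₂ (g′ , h′) x → F.⟦ C ⟧ x
    diagonal = escapes⇒∈ gg′ hh′ {C} convex u∈C v∈C

    antidiagonal : ∀ {x} → Escapes₂ (g , h′) x → Escapes₂ (g′ , h) x → F.⟦ C ⟧ x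
    antidiagonal = escapes⇒∈ gg′ h′h {C} convex
      (diagonal (inj₂ (h′ , inj₁ refl , hh′)) (inj₁ (g , inj₁ refl , Far-sym G gg′)))
      (diagonal (inj₁ (g′ , inj₁ refl , gg′)) (inj₂ (h , inj₁ refl , h′h)))

    case : Escapes G g a ⊎ Escapes G g′ a → Escapes H h b ⊎ Escapes H h′ b →
           F.⟦ C ⟧ (a , b)
    case (inj₁ e) (inj₂ f) = diagonal (inj₁ e) (inj₂ f)
    case (inj₂ e) (inj₁ f) = diagonal (inj₂ f) (inj₁ e)
    -- Both escapes concern the same diagonal corner; the antidiagonal pair gets one for each of its
    -- corners.
    case (inj₁ e) (inj₁ f) = antidiagonal (inj₁ e) (inj₂ f)
    case (inj₂ e) (inj₂ f) = antidiagonal (inj₂ f) (inj₁ e)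

theorem5p1 : (G H : Graph) → Connected G → Connected H →
    ¬ Complete G → ¬ Complete H → IsTHullNumber (G ⊠ H) 2
theorem5p1 G H connG connH ¬completeG ¬completeH
  with ¬Complete⇒∃Far G ¬completeG | ¬Complete⇒∃Far H ¬completeH
... | g , g′ , gg′ | h , h′ , hh′ =
  (⁅ i ⁆ ∪ ⁅ j ⁆ , hull , x≢y⇒∣⁅x⁆∪⁅y⁆∣≡2 (u≢v ∘ to-injective (G ⊠ H))) ,
  hullSet⇒2≤∣S∣ (G ⊠ H) u≢v
  where
  open Graph (G ⊠ H)
  i = Inverse.to enum (g , h)
  j = Inverse.to enum (g′ , h′)
  u≢v : (g , h) ≢ (g′ , h′)
  u≢v = proj₁ gg′ ∘ cong proj₁
  hull : IsTHullSet (G ⊠ H) (⁅ i ⁆ ∪ ⁅ j ⁆)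
  hull x C convex S⊆C = diagonal-hull G H connG connH gg′ hh′ {C} convex
    (S⊆C (x∈p∪q⁺ {p = ⁅ i ⁆} (inj₁ (x∈⁅x⁆ i))))
    (S⊆C (x∈p∪q⁺ {q = ⁅ j ⁆} (inj₂ (x∈⁅x⁆ j)))) x
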